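{- Let $\mathrm{H}$ be a set of Horn rules and let $\mathrm{H}'\subseteq\mathrm H$ be a fracturable subset of the dependency graph $\mathsf{DG}(\mathrm{H})$. Then $\mathrm{H}\setminus\mathrm{H}'$ permutes above $\mathrm{H}'$.
   Context: Fix a non-empty finite set $\mathtt{E}$ of edge types and a countably infinite set $\mathtt S$ of sequents (atomic labels). A g-sequent is a finite directed graph with vertices in a universe $\mathcal U$, edge relations $\mathcal{E}_a$ for $a\in\mathtt{E}$, and a labelling of vertices by sequents; it is written $\Gamma\vdash\Delta$ with $\Gamma$ the set of edge atoms $w\mathcal{E}_a u$ and $\Delta$ the set of prefixed sequents $w:S$; commas denote disjoint union. Let $\overline{\mathtt E}=\{\bar a\mid a\in\mathtt E\}$, $\bar{\bar z}=z$, $\overline{x_1\cdots x_n}=\bar x_n\cdots\bar x_1$, $\varepsilon$ the empty string. For $s=x_1\cdots x_n$, $w\mathcal{E}_s u$ abbreviates edge atoms $w\mathcal{E}_{x_1}v_1,\dots,v_{n-1}\mathcal{E}_{x_n}u$ for some vertices $v_i$, with $v\mathcal E_{\bar a}z$ meaning $z\mathcal E_a v$ and $w\mathcal E_\varepsilon u$ meaning $w=u$. A forward Horn rule $h_f$ (for $a\in\mathtt E$, string $s$) has premise $\Gamma,w\mathcal{E}_s u,w\mathcal{E}_a u\vdash\Delta$ and conclusion $\Gamma,w\mathcal{E}_s u\vdash\Delta$; a backward Horn rule $h_b$ is the same with $w\mathcal{E}_a u$ replaced by $u\mathcal{E}_a w$. Their grammars are $\mathbf{G}(h_f)=\{a\longrightarrow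 s,\bar a\longrightarrow\bar s\}$, $\mathbf{G}(h_b)=\{\bar a\longrightarrow s,a\longrightarrow\bar s\}$; for a production rule $p=x\longrightarrow t$ set $\bar p=\bar x\longrightarrow\bar t$; $(p,\bar p)$ is a production pair, and $P(\mathbf G)$ is the set of production pairs of a rule set $\mathbf G$ closed under $p\mapsto\bar p$; $P(h):=P(\mathbf G(h))$. Dependency graph: for distinct production pairs $(p,\bar p),(p',\bar p')$ with $p=x\longrightarrow s$, $p'=y\longrightarrow t$, $(p',\bar p')$ depends on $(p,\bar p)$, written $(p,\bar p)\sqsubset(p',\bar p')$, iff $s$ or $\bar s$ has the form $s_1ys_2$. $\sqsubseteq$ is the reflexive-transitive closure of $\sqsubset$. For a set $\mathrm H$ of Horn rules, $\mathsf{DG}(\mathrm H)=(\mathrm H,\sqsubseteq')$ where $h\sqsubseteq' h'$ iff $(p,\bar p)\sqsubseteq(p',\bar p')$ for $(p,\bar p)\in P(h)$, $(p',\bar p')\in P(h')$ (in the dependency relation of the union of the grammars of $\mathrm H$). In a dependency graph $(V,\sqsubseteq)$, a subset $V'\subseteq V$ is fracturable iff there are no $v\in V'$, $v'\in V\setminus V'$ with $v\sqsubseteq v'$; $V''$ is anti-fracturable iff $V''=V\setminus V'$ for some fracturable $V'$. Permutation: $\mathrm{R}_1$ permutes above $\mathrm{R}_2$ iff whenever $\mathcal{G}$ is obtained from g-sequents $\mathcal{G}_1,\dots,\mathcal{G}_n$ by an application of some $\sigma\in\mathrm{R}_2$ followed by an application of some $\rho\in\mathrm{R}_1$, then $\mathcal{G}$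 can be obtained from $\mathcal{G}_1,\dots,\mathcal{G}_n$ by applications of $\rho$ followed by an application of $\sigma$. -}

module Defs where

open import Level using (Level; 0ℓ) renaming (suc to lsuc)
open import Data.Nat using (ℕ; suc)
open import Data.Fin using (Fin)
open import Data.List using (List; []; _∷_; _++_; [_]; map; reverse)
import Data.List.Membership.Propositional as List
open import Data.List.Relation.Unary.All using (All)
open import Data.List.Relation.Unary.Unique.Propositional using (Unique)
open import Data.Product using (Σ; ∃; ∃-syntax; _×_; _,_; swap)
open import Data.Sum using (_⊎_)
open import Function.Bundles using (_↔_)
open import Relation.Binary.Core using (Rel)
open import Relation.Binary.Construct.Closure.ReflexiveTransitive using (Star)
open import Relation.Binary.PropositionalEquality using (_≡_)
open import Relation.Nullary using (¬_)
open import Relation.Unary using (Pred; _∈_; _∉_; _⊆_; _∪_; _∖_; _⊥_; _≐_; ｛_｝)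

private variable
  ℓ ℓ′ : Level

-- A finite set is a repetition-free list; two such lists are the same set when
-- their extents ⟨_⟩ agree up to _≐_.
record FinSet (A : Set) : Set where
  field
    elements : List A
    unique   : Unique elements

⟨_⟩ : {A : Set} → FinSet A → Pred A 0ℓ
⟨ X ⟩ x = x List.∈ FinSet.elements X

_≐_⊍_ : {A : Set} → Pred A 0ℓ → Pred A 0ℓ → Pred A 0ℓ → Set
X ≐ Y ⊍ Z = X ≐ (Y ∪ Z) × Y ⊥ Z

record Signature : Set₁ where
  field
    E : Set
    S : Set
    U : Set
    -- the number of edge types is suc |E|-1
    |E|-1 : ℕ
    E-finite-nonempty    : E ↔ Fin (suc |E|-1)
    S-countably-infinite : S ↔ ℕ

record DependencyGraph (A : Set) (ℓ : Level) : Set (lsuc ℓ) where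
  field
    V   : Pred A ℓ
    _⊑_ : Rel A ℓ

Fracturable : {A : Set} → DependencyGraph A ℓ → Pred A ℓ′ → Set _
Fracturable D V′ = V′ ⊆ V × ¬ (∃[ v ] ∃[ v′ ] v ∈ V′ × v′ ∈ V ∖ V′ × v ⊑ v′)
  where open DependencyGraph D

module Permutation {G : Set} where

  -- An inference rule relates lists of premises to conclusions.
  InferenceRule : Set₁
  InferenceRule = List G → G → Set

  -- σ is applied to the consecutive premises ys; its conclusion and the
  -- remaining premises are those of ρ.
  _thenOnce_ : InferenceRule → InferenceRule → InferenceRule
  (σ thenOnce ρ) Gs C =
    ∃[ xs ] ∃[ ys ] ∃[ zs ] ∃[ D ]
      Gs ≡ xs ++ ys ++ zs × σ ys D × ρ (xs ++ D ∷ zs) C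

  -- Each premise of σ is the conclusion of an application of ρ to given
  -- g-sequents.
  _onEachPremiseThen_ : InferenceRule → InferenceRule → InferenceRule
  (ρ onEachPremiseThen σ) Gs C =
    ∃[ Ds ] All (λ D → ∃[ Ps ] All (List._∈ Gs) Ps × ρ Ps D) Ds × σ Ds C

  -- R is a type of names of rules, and ⟦ r ⟧ is the rule named r.
  PermutesAbove : {R : Set} → (R → InferenceRule) → Pred R ℓ → Pred R ℓ′ → Set _
  PermutesAbove ⟦_⟧ R₁ R₂ =
    ∀ {σ ρ} → σ ∈ R₂ → ρ ∈ R₁ → ∀ Gs C →
      (⟦ σ ⟧ thenOnce ⟦ ρ ⟧) Gs C → (⟦ ρ ⟧ onEachPremiseThen ⟦ σ ⟧) Gs C

module HornRules (𝕊 : Signature) where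
  open Signature 𝕊

  -- atom w a u is the edge atom w ℰₐ u.
  record EdgeAtom : Set where
    constructor atom
    field
      source : U
      type   : E
      target : U

  -- Γ ⊢ Δ.  The vertices are those occurring in Δ, which is the graph of the
  -- labelling function.
  record GSequent : Set where
    field
      Γ : FinSet EdgeAtom
      Δ : FinSet (U × S)

    Vertex : Pred U 0ℓ
    Vertex w = ∃[ P ] (w , P) ∈ ⟨ Δ ⟩

    field
      label-unique : ∀ {w P Q} → (w , P) ∈ ⟨ Δ ⟩ → (w , Q) ∈ ⟨ Δ ⟩ → P ≡ Q
      endpoints    : ∀ {w a u} → atom w a u ∈ ⟨ Γ ⟩ → Vertex w × Vertex u

  -- E ∪ Ē
  data Letter : Set where
    plain barred : E → Letter

  bar : Letter → Letter
  bar (plain a)  = barred a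
  bar (barred a) = plain a

  Str : Set
  Str = List Letter

  barStr : Str → Str
  barStr s = reverse (map bar s)

  letterAtom : U → Letter → U → EdgeAtom
  letterAtom v (plain a)  z = atom v a z
  letterAtom v (barred a) z = atom z a v

  -- A choice of the intermediate vertices in w ℰₛ u.
  data Path : U → Str → U → Set where
    ε   : ∀ {w} → Path w [] w
    via : ∀ {w x s u} (v : U) → Path v s u → Path w (x ∷ s) u

  -- The same atom may be traversed several times: as a set of edge atoms,
  -- w ℰₛ u is the extent of this list.
  pathAtoms : ∀ {w s u} → Path w s u → List EdgeAtom
  pathAtoms ε                 = []
  pathAtoms (via {w} {x} v π) = letterAtom w x v ∷ pathAtoms π

  data HornRule : Set where
    forward backward : E → Str → HornRule

  body : HornRule → Str
  body (forward a s)  = s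
  body (backward a s) = s

  principal : HornRule → U → U → EdgeAtom
  principal (forward a s)  w u = atom w a u
  principal (backward a s) w u = atom u a w

  record HornInstance (h : HornRule) (premise conclusion : GSequent) : Set where
    private
      module P = GSequent premise
      module C = GSequent conclusion
    field
      {w u} : U
      path  : Path w (body h) u
      Γ     : FinSet EdgeAtom

    wEₛu : Pred EdgeAtom 0ℓ
    wEₛu = List._∈ pathAtoms path

    field
      conclusion-edges : ⟨ C.Γ ⟩ ≐ ⟨ Γ ⟩ ⊍ wEₛu
      premise-edges    : ⟨ P.Γ ⟩ ≐ ⟨ C.Γ ⟩ ⊍ ｛ principal h w u ｝
      same-labelling   : ⟨ P.Δ ⟩ ≐ ⟨ C.Δ ⟩

  open Permutation {GSequent} public

  ⟦_⟧ : HornRule → InferenceRule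
  ⟦ h ⟧ Gs C = ∃[ P ] Gs ≡ [ P ] × HornInstance h P C

  infix 5 _⟶_
  record Production : Set where
    constructor _⟶_
    field
      lhs : Letter
      rhs : Str
  open Production

  barProd : Production → Production
  barProd (x ⟶ t) = bar x ⟶ barStr t

  grammar : HornRule → Pred Production 0ℓ
  grammar (forward a s)  = ｛ plain a ⟶ s ｝ ∪ ｛ barred a ⟶ barStr s ｝
  grammar (backward a s) = ｛ barred a ⟶ s ｝ ∪ ｛ plain a ⟶ barStr s ｝

  grammarOf : Pred HornRule ℓ → Pred Production ℓ
  grammarOf H p = ∃[ h ] h ∈ H × p ∈ grammar h

  ProductionPairs : Pred Production ℓ → Pred (Production × Production) ℓ
  ProductionPairs 𝐆 (p , q) = p ∈ 𝐆 × q ∈ 𝐆 × q ≡ barProd p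

  -- (p , p̄) and (p̄ , p) are the same production pair.
  _≋_ : Rel (Production × Production) 0ℓ
  π ≋ π′ = π ≡ π′ ⊎ π ≡ swap π′

  HasForm : Letter → Str → Set
  HasForm y s = ∃[ s₁ ] ∃[ s₂ ] s ≡ s₁ ++ [ y ] ++ s₂

  -- The dependency relation among the production pairs of 𝐆.  It is invariant
  -- under _≋_ because HasForm y (barStr s) amounts to HasForm (bar y) s.
  Dependency : Pred Production ℓ → Rel (Production × Production) ℓ
  Dependency 𝐆 (p , p̄) (p′ , p̄′) =
      (p , p̄) ∈ ProductionPairs 𝐆
    × (p′ , p̄′) ∈ ProductionPairs 𝐆
    × ¬ ((p , p̄) ≋ (p′ , p̄′))
    × (HasForm (lhs p′) (rhs p) ⊎ HasForm (lhs p′) (barStr (rhs p)))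

  -- ProductionPairs (grammar h) is a single pair up to _≋_, so "some
  -- representatives are related" does not depend on a choice of pairs.
  DG : Pred HornRule ℓ → DependencyGraph HornRule ℓ
  DG H = record
    { V   = H
    ; _⊑_ = λ h h′ → ∃[ π ] ∃[ π′ ]
        π ∈ ProductionPairs (grammar h)
      × π′ ∈ ProductionPairs (grammar h′)
      × Star (Dependency (grammarOf H)) π π′
    }

-- Applying σ to P gives D, and applying ρ to D gives C.  The edge deleted by ρ
-- cannot lie on the path that σ requires: otherwise the body of σ would mention
-- the edge type of ρ, in one of its two orientations, so that σ ⊑ ρ, against
-- fracturability.  Hence ρ may delete its edge first, leaving C together with
-- the edge of σ, and σ then finds its path intact.

module Submission where

open import Defs
open import Level using (Level; 0ℓ)
open import Data.Empty using (⊥-elim)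
open import Data.List using (List; []; _∷_; _++_; [_]; map; reverse)
open import Data.List.Membership.Propositional.Properties using (∈-∃++)
import Data.List.Membership.Propositional as List
open import Data.List.Properties using (map-cong; map-id; map-∘; reverse-involutive; reverse-map)
open import Data.List.Relation.Binary.Permutation.Propositional using (↭-sym; ↭⇒↭ₛ)
open import Data.List.Relation.Binary.Permutation.Propositional.Properties using (shift; ∈-resp-↭)
import Data.List.Relation.Binary.Permutation.Setoid.Properties as Permutationₛ
open import Data.List.Relation.Unary.All using ([]; _∷_)
open import Data.List.Relation.Unary.All.Properties using (¬Any⇒All¬; All¬⇒¬Any)
open import Data.List.Relation.Unary.AllPairs as AllPairs using (_∷_)
open import Data.List.Relation.Unary.Any using (here; there)
open import Data.List.Relation.Unary.Unique.Propositional using (Unique)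
open import Data.Product using (∃-syntax; _×_; _,_; proj₁; proj₂; swap)
open import Data.Sum using (_⊎_; inj₁; inj₂; [_,_]′)
import Data.Sum as Sum
open import Function using (_∘_)
open import Relation.Binary.Construct.Closure.ReflexiveTransitive using (ε; _◅_)
open import Relation.Binary.PropositionalEquality
  using (_≡_; refl; sym; cong; cong₂; subst; setoid; module ≡-Reasoning)
open import Relation.Nullary using (¬_)
open import Relation.Unary using (Pred; _∈_; _∉_; _⊆_; _∖_; ｛_｝)
open import Relation.Unary.Properties using (≐-trans)

module _ {A : Set} where

  -- Horn rules have a single premise, so in `_thenOnce_` this forces `xs` and `zs` to be empty: the
  -- conclusion of `σ` is the premise of `ρ`.
  ++∷-singleton : ∀ (xs : List A) {y z zs} → xs ++ y ∷ zs ≡ [ z ] → xs ≡ [] × y ≡ z × zs ≡ []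
  ++∷-singleton []          refl = refl , refl , refl
  ++∷-singleton (_ ∷ [])    ()
  ++∷-singleton (_ ∷ _ ∷ _) ()

  remove : (X : FinSet A) {x : A} → x ∈ ⟨ X ⟩ → ∃[ Y ] ⟨ X ⟩ ≐ ⟨ Y ⟩ ⊍ ｛ x ｝
  remove X {x} x∈X with ∈-∃++ x∈X
  ... | ys , zs , X≡ = Y , (X⊆ , [ Y⊆X , x⊆X ]′) , λ { (y∈Y , refl) → All¬⇒¬Any x≢Y y∈Y }
    where
    X↭x∷Y = shift x ys zs

    -- Uniqueness survives moving `x` to the front: the head then separates `x` from `Y`, and the
    -- tail makes `Y` a `FinSet`.
    x∷Y-unique : Unique (x ∷ ys ++ zs)
    x∷Y-unique = Permutationₛ.Unique-resp-↭ (setoid A) (↭⇒↭ₛ X↭x∷Y)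
      (subst Unique X≡ (FinSet.unique X))

    x≢Y = AllPairs.head x∷Y-unique

    Y : FinSet A
    Y = record
      { elements = ys ++ zs
      ; unique   = AllPairs.tail x∷Y-unique
      }

    X⊆ : ∀ {y} → y ∈ ⟨ X ⟩ → y ∈ ⟨ Y ⟩ ⊎ x ≡ y
    X⊆ y∈X with ∈-resp-↭ X↭x∷Y (subst (_ List.∈_) X≡ y∈X)
    ... | here y≡x  = inj₂ (sym y≡x)
    ... | there y∈Y = inj₁ y∈Y

    Y⊆X : ⟨ Y ⟩ ⊆ ⟨ X ⟩
    Y⊆X = subst (_ List.∈_) (sym X≡) ∘ ∈-resp-↭ (↭-sym X↭x∷Y) ∘ there

    x⊆X : ｛ x ｝ ⊆ ⟨ X ⟩
    x⊆X refl = x∈X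

  insert : (X : FinSet A) {x : A} → x ∉ ⟨ X ⟩ → ∃[ Y ] ⟨ Y ⟩ ≐ ⟨ X ⟩ ⊍ ｛ x ｝
  insert X {x} x∉X =
      record { elements = x ∷ FinSet.elements X ; unique = ¬Any⇒All¬ _ x∉X ∷ FinSet.unique X }
    , ((λ { (here y≡x) → inj₂ (sym y≡x) ; (there y∈X) → inj₁ y∈X })
      , [ there , here ∘ sym ]′)
    , λ { (x∈X , refl) → x∉X x∈X }

  module _ {P D C D′ X Y : Pred A 0ℓ} where

    -- `P` consists of `C`, `X` and `Y`, joined in either order. `X` and `Y` are disjoint because
    -- `Y` lies inside `D`.
    ⊍-exchange : P ≐ D ⊍ X → D ≐ C ⊍ Y → D′ ≐ C ⊍ X → P ≐ D′ ⊍ Y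
    ⊍-exchange ((P⊆ , ⊆P) , D⊥X) ((D⊆ , ⊆D) , C⊥Y) ((D′⊆ , ⊆D′) , C⊥X) =
        ( [ Sum.map₁ (⊆D′ ∘ inj₁) ∘ D⊆ , inj₁ ∘ ⊆D′ ∘ inj₂ ]′ ∘ P⊆
        , [ [ ⊆P ∘ inj₁ ∘ ⊆D ∘ inj₁ , ⊆P ∘ inj₂ ]′ ∘ D′⊆ , ⊆P ∘ inj₁ ∘ ⊆D ∘ inj₂ ]′ )
      , λ (z∈D′ , z∈Y) →
          [ (λ z∈C → C⊥Y (z∈C , z∈Y)) , (λ z∈X → D⊥X (⊆D (inj₂ z∈Y) , z∈X)) ]′ (D′⊆ z∈D′)

    -- Both `D′` and `C` with `X` are what remains of `P` outside `Y`: disjointness makes every case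
    -- `z ∈ Y` absurd.
    ⊍-cancel : P ≐ D ⊍ X → D ≐ C ⊍ Y → P ≐ D′ ⊍ Y → D′ ≐ C ⊍ X
    ⊍-cancel ((P⊆ , ⊆P) , D⊥X) ((D⊆ , ⊆D) , C⊥Y) ((P⊆′ , ⊆P′) , D′⊥Y) =
        ( (λ z∈D′ → [ (λ z∈D → [ inj₁ , (λ z∈Y → ⊥-elim (D′⊥Y (z∈D′ , z∈Y))) ]′ (D⊆ z∈D))
                    , inj₂ ]′ (P⊆ (⊆P′ (inj₁ z∈D′))))
        , [ (λ z∈C → [ (λ z∈D′ → z∈D′) , (λ z∈Y → ⊥-elim (C⊥Y (z∈C , z∈Y))) ]′
                       (P⊆′ (⊆P (inj₁ (⊆D (inj₁ z∈C))))))
          , (λ z∈X → [ (λ z∈D′ → z∈D′) , (λ z∈Y → ⊥-elim (D⊥X (⊆D (inj₂ z∈Y) , z∈X))) ]′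
                       (P⊆′ (⊆P (inj₂ z∈X)))) ]′ )
      , λ (z∈C , z∈X) → D⊥X (⊆D (inj₁ z∈C) , z∈X)

module _ (𝕊 : Signature) where
  open HornRules 𝕊
  open Production

  bar-involutive : ∀ x → bar (bar x) ≡ x
  bar-involutive (plain a)  = refl
  bar-involutive (barred a) = refl

  barStr-involutive : ∀ s → barStr (barStr s) ≡ s
  barStr-involutive s = begin
    barStr (barStr s)         ≡⟨ cong reverse (reverse-map bar (map bar s)) ⟩
    reverse (reverse ss)      ≡⟨ reverse-involutive ss ⟩
    ss                        ≡⟨ map-∘ s ⟨
    map (bar ∘ bar) s         ≡⟨ map-cong bar-involutive s ⟩
    map (λ x → x) s           ≡⟨ map-id s ⟩
    s                         ∎
    where
    open ≡-Reasoning
    ss = map bar (map bar s)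

  barProd-involutive : ∀ p → barProd (barProd p) ≡ p
  barProd-involutive (x ⟶ s) = cong₂ _⟶_ (bar-involutive x) (barStr-involutive s)

  swap-ProductionPairs : ∀ {ℓ} (𝐆 : Pred Production ℓ) {π} →
    π ∈ ProductionPairs 𝐆 → swap π ∈ ProductionPairs 𝐆
  swap-ProductionPairs _ (p∈𝐆 , q∈𝐆 , refl) = q∈𝐆 , p∈𝐆 , sym (barProd-involutive _)

  -- The letter that reads the principal edge from `w` to `u`, so that forward and backward rules
  -- can be treated alike.
  head : HornRule → Letter
  head (forward a s)  = plain a
  head (backward a s) = barred a

  principal≡letterAtom : ∀ h w u → principal h w u ≡ letterAtom w (head h) u
  principal≡letterAtom (forward a s)  w u = refl
  principal≡letterAtom (backward a s) w u = refl

  production : HornRule → Production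
  production h = head h ⟶ body h

  pair : HornRule → Production × Production
  pair h = production h , barProd (production h)

  pair∈ : ∀ h → pair h ∈ ProductionPairs (grammar h)
  pair∈ (forward a s)  = inj₁ refl , inj₂ refl , refl
  pair∈ (backward a s) = inj₁ refl , inj₂ refl , refl

  -- An edge can be traversed in either direction, so its atom determines the letter only up to
  -- `bar`.
  letterAtom-injective : ∀ x y {w u w′ u′} →
    letterAtom w x u ≡ letterAtom w′ y u′ → x ≡ y ⊎ bar x ≡ y
  letterAtom-injective (plain a)  (plain .a)  refl = inj₁ refl
  letterAtom-injective (plain a)  (barred .a) refl = inj₂ refl
  letterAtom-injective (barred a) (plain .a)  refl = inj₂ refl
  letterAtom-injective (barred a) (barred .a) refl = inj₁ refl

  ∈pathAtoms⇒∈ : ∀ x {w u w′ s u′} (π : Path w′ s u′) →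
    letterAtom w x u List.∈ pathAtoms π → x List.∈ s ⊎ bar x List.∈ s
  ∈pathAtoms⇒∈ x (via {x = y} v π) (here eq) = Sum.map here here (letterAtom-injective x y eq)
  ∈pathAtoms⇒∈ x (via v π) (there e∈π)       = Sum.map there there (∈pathAtoms⇒∈ x π e∈π)

  module _ {ℓ} {H : Pred HornRule ℓ} where
    open DependencyGraph (DG H)

    grammar-pairs⊆ : ∀ {h} → h ∈ H →
      ProductionPairs (grammar h) ⊆ ProductionPairs (grammarOf H)
    grammar-pairs⊆ h∈H (p∈ , q∈ , eq) = (_ , h∈H , p∈) , (_ , h∈H , q∈) , eq

    -- The double negation stands for the undecided case distinction whether h
    -- and h′ have the same production pair, as forward a s and
    -- backward a (barStr s) do.
    pair-dependency : ∀ {h h′ π′} → h ∈ H → h′ ∈ H → π′ ∈ ProductionPairs (grammar h′) →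
      lhs (proj₁ π′) List.∈ body h → ¬ ¬ (h ⊑ h′)
    pair-dependency {h} {h′} {π′} h∈H h′∈H π′∈ y∈s h⋢h′ =
      h⋢h′ (_ , _ , pair∈ h , π′∈ ,
        (grammar-pairs⊆ h∈H (pair∈ h) , grammar-pairs⊆ h′∈H π′∈ , distinct , inj₁ (∈-∃++ y∈s)) ◅ ε)
      where
      -- `Dependency` relates distinct pairs only; for coinciding pairs the reflexivity of `Star`
      -- yields `h ⊑ h′` instead.
      distinct : ¬ (pair h ≋ π′)
      distinct (inj₁ refl) = h⋢h′ (_ , _ , pair∈ h , π′∈ , ε)
      distinct (inj₂ refl) = h⋢h′ (_ , _ , pair∈ h , swap-ProductionPairs (grammar h′) π′∈ , ε)

    principal∈path⇒⊑ : ∀ {h h′ w u w′ u′} → h ∈ H → h′ ∈ H → {π : Path w (body h) u} →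
      principal h′ w′ u′ List.∈ pathAtoms π → ¬ ¬ (h ⊑ h′)
    principal∈path⇒⊑ {h′ = h′} h∈H h′∈H {π} e∈π =
      [ pair-dependency {π′ = pair h′} h∈H h′∈H (pair∈ h′)
      -- The barred letter is the left-hand side of the second production, and `Dependency` inspects
      -- the first; hence the swap.
      , pair-dependency {π′ = swap (pair h′)} h∈H h′∈H
          (swap-ProductionPairs (grammar h′) {pair h′} (pair∈ h′)) ]′
      (∈pathAtoms⇒∈ (head h′) π (subst (List._∈ pathAtoms π) (principal≡letterAtom h′ _ _) e∈π))

  module _ {σ ρ : HornRule} {P D C : GSequent}
           (I : HornInstance σ P D) (J : HornInstance ρ D C) where
    private
      module P = GSequent P
      module C = GSequent C
      module I = HornInstance I
      module J = HornInstance J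

    instances-commute : principal ρ J.w J.u ∉ I.wEₛu →
      ∃[ D′ ] HornInstance ρ P D′ × HornInstance σ D′ C
    instances-commute ρ∉path = D′ , ρ-instance , σ-instance
      where
      σ-edge = principal σ I.w I.u

      -- Edges of `C` are edges of `D`, from which the edge deleted by `σ` is absent.
      σ∉C : σ-edge ∉ ⟨ C.Γ ⟩
      σ∉C σ∈C = proj₂ I.premise-edges (proj₂ (proj₁ J.premise-edges) (inj₁ σ∈C) , refl)

      σ∉Γ : σ-edge ∉ ⟨ J.Γ ⟩
      σ∉Γ = σ∉C ∘ proj₂ (proj₁ J.conclusion-edges) ∘ inj₁

      -- An edge of `D` lies in the context or on the path of `σ`, and `ρ∉path` excludes the latter.
      ρ∈Γ : principal ρ J.w J.u ∈ ⟨ I.Γ ⟩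
      ρ∈Γ = [ (λ ρ∈ → ρ∈) , ⊥-elim ∘ ρ∉path ]′
        (proj₁ (proj₁ I.conclusion-edges) (proj₂ (proj₁ J.premise-edges) (inj₂ refl)))

      D′-edges   = insert C.Γ σ∉C
      P-edges    = ⊍-exchange I.premise-edges J.premise-edges (proj₂ D′-edges)
      -- `ρ` now acts while the edge of `σ` is still present, and `σ` acts once the edge of `ρ` is
      -- gone; the two contexts change accordingly.
      ρ-context  = insert J.Γ σ∉Γ
      σ-context  = remove I.Γ ρ∈Γ

      D′ : GSequent
      D′ = record
        { Γ            = proj₁ D′-edges
        ; Δ            = P.Δ
        ; label-unique = P.label-unique
        -- The edges of `D′` are among those of `P`, so the vertices of `P` cover their endpoints.
        ; endpoints    = P.endpoints ∘ proj₂ (proj₁ P-edges) ∘ inj₁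
        }

      ρ-instance : HornInstance ρ P D′
      ρ-instance = record
        { path             = J.path
        ; Γ                = proj₁ ρ-context
        ; conclusion-edges =
            ⊍-exchange (proj₂ D′-edges) J.conclusion-edges (proj₂ ρ-context)
        ; premise-edges    = P-edges
        ; same-labelling   = (λ z → z) , (λ z → z)
        }

      σ-instance : HornInstance σ D′ C
      σ-instance = record
        { path             = I.path
        ; Γ                = proj₁ σ-context
        ; conclusion-edges =
            ⊍-cancel I.conclusion-edges (proj₂ σ-context) J.premise-edges
        ; premise-edges    = proj₂ D′-edges
        ; same-labelling   = ≐-trans I.same-labelling J.same-labelling
        }

mainTheorem5 : ∀ {ℓ ℓ′ : Level} (𝕊 : Signature) → let open HornRules 𝕊 in
    (H : Pred HornRule ℓ) (H′ : Pred HornRule ℓ′) → H′ ⊆ H →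
    Fracturable (DG H) H′ →
    PermutesAbove ⟦_⟧ (H ∖ H′) H′
mainTheorem5 𝕊 H H′ H′⊆H (_ , not-below) σ∈H′ (ρ∈H , ρ∉H′) _ C
  (xs , _ , zs , D , refl , (P , refl , I) , (_ , eq , J)) with ++∷-singleton xs eq
... | refl , refl , refl =
  -- Avoiding the path is itself a negation, so the doubly negated `σ ⊑ ρ` suffices to contradict
  -- fracturability.
  let σ⋢ρ = λ σ⊑ρ → not-below (_ , _ , σ∈H′ , (ρ∈H , ρ∉H′) , σ⊑ρ)
      D′ , ρ-instance , σ-instance = instances-commute 𝕊 I J
        (λ ρ∈path → principal∈path⇒⊑ 𝕊 (H′⊆H σ∈H′) ρ∈H ρ∈path σ⋢ρ)
  in [ D′ ] , (([ P ] , here refl ∷ [] , P , refl , ρ-instance) ∷ []) , D′ , refl , σ-instance
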